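{- For every $n\in\mathbb{N}$, $n\ge 1$, the Boolean network $f^{[n]}$ (defined recursively in the context) is unate.
   Context: A Boolean network with $n$ variables is a map $f=(f_1,\dots,f_n):\{0,1\}^n\to\{0,1\}^n$; write $[n]=\{1,\dots,n\}$. Let $e_i$ be the $i$-th unit vector and $\oplus$ componentwise addition modulo 2. The function $f_j$ is increasing (resp. decreasing) in component $i$ if $f_j(x)\le f_j(x\oplus e_i)$ (resp. $f_j(x)\ge f_j(x\oplus e_i)$) for every $x$ with $x_i=0$. $f_j$ is unate if for each $i\in[n]$ it is increasing or decreasing in component $i$; the network is unate if all $f_j$ are unate. For a configuration $x$, $\overline{x}$ denotes the componentwise negation and $x_{[m]}=(x_1,\dots,x_m)$; $\vec 0$ is the all-zeros configuration. Recursive construction: $f^{[1]}(x_1)=\overline{x_1}$. Given $f^{[n]}:\{0,1\}^n\to\{0,1\}^n$ ($n\ge1$), let $z=z^{[n+1]}\in\{0,1\}^{n+1}$ be the configuration with $z_{n+1}=0$ and $f^{[n]}(z_{[n]})=\vec 0$ (it exists and is unique because each $f^{[n]}$ is a bijection). Put $h^{[n+1]}(x)=(f^{[n]}(x_{[n]}),x_{n+1})$ for $x\in\{0,1\}^{n+1}$, and $$f^{[n+1]}_i(x)=\bigl(h^{[n+1]}_i(x)\land d_{\overline z}(x)\bigr)\lor c_z(x),\qquad i\in[n+1],$$ where $c_z,d_{\overline z}:\{0,1\}^{n+1}\to\{0,1\}$ are given by $c_z(x)=1$ if and only if $x=z$, and $d_{\overline z}(x)=0$ if and only if $x=\overline z$.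 -}

module Defs where

open import Data.Bool.Base using (Bool; true; false; not; _∧_; _∨_; _xor_; _≤_; if_then_else_)
open import Data.Bool.Properties as Bool
  using (∧-identityʳ; ∨-identityʳ; ∨-zeroʳ; ∧-zeroʳ; not-involutive)
open import Data.Fin.Base using (Fin)
open import Data.Nat.Base using (ℕ; zero; suc; NonZero)
open import Data.Product.Base using (∃; _×_; _,_; proj₁; proj₂)
open import Data.Sum.Base using (_⊎_)
open import Data.Vec.Base
  using (Vec; _∷_; _∷ʳ_; init; last; initLast; lookup; map; replicate; tabulate; zipWith; _[_]≔_)
open import Data.Vec.Properties
  using (≡-dec; map-cong; map-id; map-∘; map-∷ʳ; init-∷ʳ; last-∷ʳ; ∷ʳ-injective; map-replicate;
         tabulate-cong; tabulate∘lookup)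
open import Function.Base using (_∘_)
open import Function.Consequences.Propositional using (strictlySurjective⇒surjective)
open import Function.Definitions using (Injective; Bijective; StrictlySurjective)
open import Relation.Binary.Definitions using (DecidableEquality)
open import Relation.Binary.PropositionalEquality
  using (_≡_; _≢_; refl; sym; trans; cong; cong₂; module ≡-Reasoning)
open import Relation.Nullary using (yes; no; contradiction)
open import Relation.Nullary.Decidable using (⌊_⌋)

private variable
  n : ℕ

Config : ℕ → Set
Config n = Vec Bool n

Network : ℕ → Set
Network n = Config n → Config n

infix 4 _≟_
_≟_ : DecidableEquality (Config n)
_≟_ = ≡-dec Bool._≟_

zeros ones : Config n
zeros = replicate _ false
ones  = replicate _ true

negate : Config n → Config n
negate = map not

e : Fin n → Config n
e i = zeros [ i ]≔ true

infixl 6 _⊕_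
_⊕_ : Config n → Config n → Config n
_⊕_ = zipWith _xor_

IncreasingIn DecreasingIn : Fin n → (Config n → Bool) → Set
IncreasingIn i g = ∀ x → lookup x i ≡ false → g x ≤ g (x ⊕ e i)
DecreasingIn i g = ∀ x → lookup x i ≡ false → g (x ⊕ e i) ≤ g x

UnateFunction : (Config n → Bool) → Set
UnateFunction g = ∀ i → IncreasingIn i g ⊎ DecreasingIn i g

Unate : Network n → Set
Unate g = ∀ j → UnateFunction (λ x → lookup (g x) j)

c d : Config n → Config n → Bool
c w x = ⌊ x ≟ w ⌋
d w x = not ⌊ x ≟ w ⌋

-- On n + 1 variables, init x is x restricted to [n] and last x is the
-- component of index n + 1.

h : Network n → Network (suc n)
h g x = g (init x) ∷ʳ last x

step : Network n → Config (suc n) → Network (suc n)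
step g z x = tabulate λ i → (lookup (h g x) i ∧ d (negate z) x) ∨ c z x

-- The recursive step needs a preimage of zeros, which exists because every
-- network of the family is a bijection. Proving that bijectivity is preserved
-- needs in turn that every network of the family commutes with negation, as
-- this gives h g (negate z) ≡ ones. The step then exchanges the values
-- zeros and ones of h g and leaves all its other values unchanged.

SelfDual : Network n → Set
SelfDual g = ∀ x → g (negate x) ≡ negate (g x)

negate-involutive : (x : Config n) → negate (negate x) ≡ x
negate-involutive x =
  trans (sym (map-∘ not not x)) (trans (map-cong not-involutive x) (map-id x))

negate-injective : {x y : Config n} → negate x ≡ negate y → x ≡ y
negate-injective {x = x} {y} eq =
  trans (sym (negate-involutive x)) (trans (cong negate eq) (negate-involutive y))

negate-zeros : negate (zeros {n}) ≡ ones
negate-zeros {n} = map-replicate not false n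

negate-ones : negate (ones {n}) ≡ zeros
negate-ones {n} = map-replicate not true n

replicate-∷ʳ : (b : Bool) (n : ℕ) → replicate n b ∷ʳ b ≡ replicate (suc n) b
replicate-∷ʳ b zero    = refl
replicate-∷ʳ b (suc n) = cong (b ∷_) (replicate-∷ʳ b n)

tabulate-const : (b : Bool) (n : ℕ) → tabulate {n = n} (λ _ → b) ≡ replicate n b
tabulate-const b zero    = refl
tabulate-const b (suc n) = cong (b ∷_) (tabulate-const b n)

init∷ʳlast : (x : Config (suc n)) → init x ∷ʳ last x ≡ x
init∷ʳlast x = sym (proj₂ (proj₂ (initLast x)))

h-∷ʳ : (g : Network n) (y : Config n) (b : Bool) → h g (y ∷ʳ b) ≡ g y ∷ʳ b
h-∷ʳ g y b = cong₂ _∷ʳ_ (cong g (init-∷ʳ b y)) (last-∷ʳ b y)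

h-selfDual : {g : Network n} → SelfDual g → SelfDual (h g)
h-selfDual {g = g} sd x = begin
  h g (negate x)                         ≡⟨ cong (h g ∘ negate) (init∷ʳlast x) ⟨
  h g (negate (init x ∷ʳ last x))        ≡⟨ cong (h g) (map-∷ʳ not (last x) (init x)) ⟩
  h g (negate (init x) ∷ʳ not (last x))  ≡⟨ h-∷ʳ g _ _ ⟩
  g (negate (init x)) ∷ʳ not (last x)    ≡⟨ cong (_∷ʳ not (last x)) (sd (init x)) ⟩
  negate (g (init x)) ∷ʳ not (last x)    ≡⟨ map-∷ʳ not (last x) (g (init x)) ⟨
  negate (h g x)                         ∎
  where open ≡-Reasoning

h-injective : {g : Network n} → Injective _≡_ _≡_ g → Injective _≡_ _≡_ (h g)
h-injective {g = g} inj {x} {y} eq with ∷ʳ-injective (g (init x)) (g (init y)) eq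
... | eq₁ , eq₂ =
  trans (sym (init∷ʳlast x)) (trans (cong₂ _∷ʳ_ (inj eq₁) eq₂) (init∷ʳlast y))

strictlySurjective : {g : Network n} → Bijective _≡_ _≡_ g → StrictlySurjective _≡_ g
strictlySurjective (_ , surj) y = proj₁ (surj y) , proj₂ (surj y) refl

h-surjective : {g : Network n} → StrictlySurjective _≡_ g → StrictlySurjective _≡_ (h g)
h-surjective {g = g} surj y with surj (init y)
... | x , eq = x ∷ʳ last y ,
  trans (h-∷ʳ g x (last y)) (trans (cong (_∷ʳ last y) eq) (init∷ʳlast y))

swap : Network (suc n)
swap y = if ⌊ y ≟ zeros ⌋ then ones else (if ⌊ y ≟ ones ⌋ then zeros else y)

swap-zeros : swap (zeros {suc n}) ≡ ones
swap-zeros {n} with zeros {suc n} ≟ zeros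
... | yes _ = refl
... | no ¬p = contradiction refl ¬p

swap-ones : swap (ones {suc n}) ≡ zeros
swap-ones {n} with ones {suc n} ≟ ones
... | yes _ = refl
... | no ¬p = contradiction refl ¬p

swap-other : {y : Config (suc n)} → y ≢ zeros → y ≢ ones → swap y ≡ y
swap-other {y = y} y≢0 y≢1 with y ≟ zeros | y ≟ ones
... | yes p | _     = contradiction p y≢0
... | no _  | yes p = contradiction p y≢1
... | no _  | no _  = refl

swap-involutive : (y : Config (suc n)) → swap (swap y) ≡ y
swap-involutive {n} y = helper (y ≟ zeros) (y ≟ ones)
  where
  helper : _ → _ → swap (swap y) ≡ y
  helper (yes refl) _ = trans (cong swap (swap-zeros {n})) swap-ones
  helper (no _) (yes refl) = trans (cong swap (swap-ones {n})) swap-zeros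
  helper (no p) (no q) = trans (cong swap (swap-other p q)) (swap-other p q)

swap-selfDual : SelfDual (swap {n})
swap-selfDual {n} y = helper (y ≟ zeros) (y ≟ ones)
  where
  helper : _ → _ → swap (negate y) ≡ negate (swap y)
  helper (yes refl) _ =
    trans (cong swap (negate-zeros {suc n}))
      (trans swap-ones (sym (trans (cong negate (swap-zeros {n})) negate-ones)))
  helper (no _) (yes refl) =
    trans (cong swap (negate-ones {suc n}))
      (trans swap-zeros (sym (trans (cong negate (swap-ones {n})) negate-zeros)))
  helper (no p) (no q) =
    trans (swap-other (λ eq → q (negate-injective (trans eq (sym negate-ones))))
                      (λ eq → p (negate-injective (trans eq (sym negate-zeros)))))
          (cong negate (sym (swap-other p q)))

module _ {g : Network n} (bij : Bijective _≡_ _≡_ g) (sd : SelfDual g)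
         {z₀ : Config n} (gz₀ : g z₀ ≡ zeros) where

  private
    w : Config (suc n)
    w = z₀ ∷ʳ false

    h-w : h g w ≡ zeros
    h-w = trans (h-∷ʳ g z₀ false) (trans (cong (_∷ʳ false) gz₀) (replicate-∷ʳ false n))

    h-w̄ : h g (negate w) ≡ ones
    h-w̄ = trans (h-selfDual sd w) (trans (cong negate h-w) negate-zeros)

  step-swap : ∀ x → step g w x ≡ swap (h g x)
  step-swap x with x ≟ w | x ≟ negate w
  ... | yes refl | q =
    trans (tabulate-cong (λ i → ∨-zeroʳ (lookup (h g x) i ∧ not ⌊ q ⌋)))
      (trans (tabulate-const true (suc n)) (sym (trans (cong swap h-w) swap-zeros)))
  ... | no _ | yes refl =
    trans (tabulate-cong (λ i → trans (∨-identityʳ _) (∧-zeroʳ (lookup (h g x) i))))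
      (trans (tabulate-const false (suc n)) (sym (trans (cong swap h-w̄) swap-ones)))
  ... | no x≢w | no x≢w̄ =
    trans (tabulate-cong (λ i → trans (∨-identityʳ _) (∧-identityʳ (lookup (h g x) i))))
      (trans (tabulate∘lookup (h g x))
        (sym (swap-other (λ eq → x≢w (h-inj (trans eq (sym h-w))))
                         (λ eq → x≢w̄ (h-inj (trans eq (sym h-w̄)))))))
    where
    h-inj : Injective _≡_ _≡_ (h g)
    h-inj = h-injective (proj₁ bij)

  step-bijective : Bijective _≡_ _≡_ (step g w)
  step-bijective = injective , strictlySurjective⇒surjective surjective
    where
    injective : Injective _≡_ _≡_ (step g w)
    injective {x} {y} eq = h-injective (proj₁ bij)
      (trans (sym (swap-involutive (h g x)))
        (trans (cong swap (trans (sym (step-swap x)) (trans eq (step-swap y))))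
          (swap-involutive (h g y))))

    surjective : StrictlySurjective _≡_ (step g w)
    surjective y with h-surjective (strictlySurjective bij) (swap y)
    ... | x , eq = x , trans (step-swap x) (trans (cong swap eq) (swap-involutive y))

  step-selfDual : SelfDual (step g w)
  step-selfDual x =
    trans (step-swap (negate x))
      (trans (cong swap (h-selfDual sd x))
        (trans (swap-selfDual (h g x)) (cong negate (sym (step-swap x)))))

f           : ∀ n → .{{NonZero n}} → Network n
f-bijective : ∀ n .{{_ : NonZero n}} → Bijective _≡_ _≡_ (f n)
f-selfDual  : ∀ n .{{_ : NonZero n}} → SelfDual (f n)

f⁻¹zeros : ∀ n .{{_ : NonZero n}} → ∃ λ x → f n x ≡ zeros
f⁻¹zeros n = strictlySurjective (f-bijective n) zeros

-- z n is the configuration on n + 1 variables used to build f (suc n) from f n.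
z : ∀ n → .{{NonZero n}} → Config (suc n)
z n = proj₁ (f⁻¹zeros n) ∷ʳ false

f (suc zero)        = negate
f (suc n@(suc _))   = step (f n) (z n)

f-bijective (suc zero) = injective , strictlySurjective⇒surjective surjective
  where
  injective : Injective _≡_ _≡_ (f 1)
  injective = negate-injective
  surjective : StrictlySurjective _≡_ (f 1)
  surjective y = negate y , negate-involutive y
f-bijective (suc n@(suc _)) =
  step-bijective (f-bijective n) (f-selfDual n) (proj₂ (f⁻¹zeros n))

f-selfDual (suc zero) _ = refl
f-selfDual (suc n@(suc _)) =
  step-selfDual (f-bijective n) (f-selfDual n) (proj₂ (f⁻¹zeros n))

z-last : ∀ n .{{_ : NonZero n}} → last (z n) ≡ false
z-last n = last-∷ʳ false (proj₁ (f⁻¹zeros n))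

z-init : ∀ n .{{_ : NonZero n}} → f n (init (z n)) ≡ zeros
z-init n = trans (cong (f n) (init-∷ʳ false (proj₁ (f⁻¹zeros n)))) (proj₂ (f⁻¹zeros n))

z-unique : ∀ n .{{_ : NonZero n}} (w : Config (suc n)) →
           last w ≡ false → f n (init w) ≡ zeros → w ≡ z n
z-unique n w lw fw = trans (sym (init∷ʳlast w))
  (cong₂ _∷ʳ_ (proj₁ (f-bijective n) (trans fw (sym (proj₂ (f⁻¹zeros n))))) lw)

{-# OPTIONS --safe #-}

-- The configurations z are the alternating words ending in 0, so f n has a
-- closed form: if a is the length of the longest alternating prefix of x, then
-- component i of f n x is x_i when a < i, and ¬ x_a otherwise. From this the
-- sign of the dependence of component i on x_j can be read off: decreasing for
-- j > i and for j = i = 1, increasing for j = i > 1, and for j < i increasing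
-- exactly when i - j is odd.

module Submission where

open import Defs
open import Data.Bool.Base using (Bool; true; false; not; _∧_; _≤_; f≤t; b≤b)
open import Data.Bool.Properties
  using (∧-identityʳ; ∨-identityʳ; ∨-zeroʳ; not-involutive; xor-identityʳ;
         ≤-refl; ≤-trans; ≤-minimum; ≤-maximum)
open import Data.Fin.Base using (Fin; zero; suc)
open import Data.Nat.Base using (ℕ; zero; suc; NonZero)
open import Data.Product.Base using (∃; _×_; _,_)
open import Data.Sum.Base using (_⊎_; inj₁; inj₂)
open import Data.Vec.Base using ([]; _∷_; _∷ʳ_; init; last; lookup; replicate)
open import Data.Vec.Properties
  using (init-∷ʳ; last-∷ʳ; zipWith-identityʳ; tabulate-cong; tabulate∘lookup)
open import Function.Base using (_∘_)
open import Relation.Binary.PropositionalEquality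
  using (_≡_; _≢_; refl; sym; trans; cong; cong₂; subst; subst₂; module ≡-Reasoning)
open import Relation.Nullary using (yes; no; contradiction)

private variable
  n : ℕ

-- The closed form and its values on alternating words.

-- runEnd b xs is the negated last bit of the longest alternating prefix of b ∷ xs.
runEnd : Bool → Config n → Bool
runEnd b     []           = not b
runEnd false (false ∷ xs) = true
runEnd false (true  ∷ xs) = runEnd true xs
runEnd true  (false ∷ xs) = runEnd false xs
runEnd true  (true  ∷ xs) = false

-- Here `b` is the last bit of the run read so far. Positions of `xs` inside the run receive the
-- negated last bit of the run; the others are copied.
flipRun : Bool → Config n → Config n
flipRun b     []           = []
flipRun false (false ∷ xs) = false ∷ xs
flipRun false (true  ∷ xs) = runEnd true xs ∷ flipRun true xs
flipRun true  (false ∷ xs) = runEnd false xs ∷ flipRun false xs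
flipRun true  (true  ∷ xs) = true ∷ xs

closedForm : Network n
closedForm []       = []
closedForm (b ∷ xs) = runEnd b xs ∷ flipRun b xs

alternating : Bool → ∀ n → Config n
alternating b zero    = []
alternating b (suc n) = b ∷ alternating (not b) n

-- The last bit of alternating b (suc n).
end : Bool → ℕ → Bool
end b zero    = b
end b (suc n) = end (not b) n

end-not : ∀ b n → end (not b) n ≡ not (end b n)
end-not b zero    = refl
end-not b (suc n) = end-not (not b) n

negate-alternating : ∀ b n → negate (alternating b n) ≡ alternating (not b) n
negate-alternating b zero    = refl
negate-alternating b (suc n) = cong (not b ∷_) (negate-alternating (not b) n)

alternating-∷ʳ : ∀ b n → alternating b (suc n) ∷ʳ not (end b n) ≡ alternating b (suc (suc n))
alternating-∷ʳ b zero    = refl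
alternating-∷ʳ b (suc n) = cong (b ∷_) (alternating-∷ʳ (not b) n)

runEnd-alternating : ∀ b n → runEnd b (alternating (not b) n) ≡ not (end b n)
runEnd-alternating b     zero    = refl
runEnd-alternating false (suc n) = runEnd-alternating true n
runEnd-alternating true  (suc n) = runEnd-alternating false n

flipRun-alternating : ∀ b n → flipRun b (alternating (not b) n) ≡ replicate n (not (end b n))
flipRun-alternating b     zero    = refl
flipRun-alternating false (suc n) = cong₂ _∷_ (runEnd-alternating true n) (flipRun-alternating true n)
flipRun-alternating true  (suc n) = cong₂ _∷_ (runEnd-alternating false n) (flipRun-alternating false n)

closedForm-alternating : ∀ b n →
  closedForm (alternating b (suc n)) ≡ replicate (suc n) (not (end b n))
closedForm-alternating b n = cong₂ _∷_ (runEnd-alternating b n) (flipRun-alternating b n)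

-- Appending a bit to a word.

-- Since `b ∷ y ∷ʳ c` is not alternating, its longest alternating prefix lies within `b ∷ y`, so `c`
-- does not move the end of the run.
runEnd-∷ʳ : ∀ b (y : Config n) c → y ∷ʳ c ≢ alternating (not b) (suc n) →
            runEnd b (y ∷ʳ c) ≡ runEnd b y
runEnd-∷ʳ false []          false _ = refl
runEnd-∷ʳ false []          true  ≢ = contradiction refl ≢
runEnd-∷ʳ true  []          false ≢ = contradiction refl ≢
runEnd-∷ʳ true  []          true  _ = refl
runEnd-∷ʳ false (false ∷ y) c     _ = refl
runEnd-∷ʳ false (true ∷ y)  c     ≢ = runEnd-∷ʳ true y c (≢ ∘ cong (true ∷_))
runEnd-∷ʳ true  (false ∷ y) c     ≢ = runEnd-∷ʳ false y c (≢ ∘ cong (false ∷_))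
runEnd-∷ʳ true  (true ∷ y)  c     _ = refl

flipRun-∷ʳ : ∀ b (y : Config n) c → y ∷ʳ c ≢ alternating (not b) (suc n) →
             flipRun b (y ∷ʳ c) ≡ flipRun b y ∷ʳ c
flipRun-∷ʳ false []          false _ = refl
flipRun-∷ʳ false []          true  ≢ = contradiction refl ≢
flipRun-∷ʳ true  []          false ≢ = contradiction refl ≢
flipRun-∷ʳ true  []          true  _ = refl
flipRun-∷ʳ false (false ∷ y) c     _ = refl
flipRun-∷ʳ false (true ∷ y)  c     ≢ =
  cong₂ _∷_ (runEnd-∷ʳ true y c (≢ ∘ cong (true ∷_))) (flipRun-∷ʳ true y c (≢ ∘ cong (true ∷_)))
flipRun-∷ʳ true  (false ∷ y) c     ≢ =
  cong₂ _∷_ (runEnd-∷ʳ false y c (≢ ∘ cong (false ∷_))) (flipRun-∷ʳ false y c (≢ ∘ cong (false ∷_)))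
flipRun-∷ʳ true  (true ∷ y)  c     _ = refl

-- Away from the two alternating words, the closed form thus obeys the same recursion as `h`.
closedForm-∷ʳ : (y : Config (suc n)) (c : Bool) → (∀ b → y ∷ʳ c ≢ alternating b (suc (suc n))) →
                closedForm (y ∷ʳ c) ≡ closedForm y ∷ʳ c
closedForm-∷ʳ (b ∷ y) c ≢ =
  cong₂ _∷_ (runEnd-∷ʳ b y c (≢ b ∘ cong (b ∷_))) (flipRun-∷ʳ b y c (≢ b ∘ cong (b ∷_)))

-- Identification of `f n` with the closed form.

step-z : (g : Network n) (w : Config (suc n)) → step g w w ≡ ones
step-z {n} g w with w ≟ w
... | yes _  = trans (tabulate-cong (λ i → ∨-zeroʳ (lookup (h g w) i ∧ d (negate w) w)))
                     (tabulate-const true (suc n))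
... | no w≢w = contradiction refl w≢w

step-other : (g : Network n) {w x : Config (suc n)} → x ≢ w → x ≢ negate w → step g w x ≡ h g x
step-other g {w} {x} x≢w x≢w̄ with x ≟ w | x ≟ negate w
... | yes p | _     = contradiction p x≢w
... | no _  | yes p = contradiction p x≢w̄
... | no _  | no _  =
  trans (tabulate-cong (λ i → trans (∨-identityʳ _) (∧-identityʳ (lookup (h g x) i))))
        (tabulate∘lookup (h g x))

f-z : ∀ n .{{_ : NonZero n}} → f (suc n) (z n) ≡ ones
f-z n@(suc _) = step-z (f n) (z n)

f-negate-z : ∀ n .{{_ : NonZero n}} → f (suc n) (negate (z n)) ≡ zeros
f-negate-z n = trans (f-selfDual (suc n) (z n)) (trans (cong negate (f-z n)) negate-ones)

-- The step sends `z n` to `ones`, so by self-duality `negate (z n)` is the preimage of `zeros`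
-- under `f (suc n)`.
z-suc : ∀ n .{{_ : NonZero n}} → z (suc n) ≡ negate (z n) ∷ʳ false
z-suc n = sym (z-unique (suc n) (negate (z n) ∷ʳ false) (last-∷ʳ false (negate (z n)))
  (trans (cong (f (suc n)) (init-∷ʳ false (negate (z n)))) (f-negate-z n)))

-- The current word ends in `false`, so its negation ends in `true` and the bit `false` appended by
-- `z-suc` continues the alternation. The last bit is recorded for this induction.
z-alternating : ∀ n .{{_ : NonZero n}} → ∃ λ b → z n ≡ alternating b (suc n) × end b n ≡ false
z-alternating (suc zero) = true , sym (z-unique 1 (true ∷ false ∷ []) refl refl) , refl
z-alternating (suc n@(suc _)) with z-alternating n
... | b , z≡ , end≡ = not b , z-eq , trans (cong (λ a → end a n) (not-involutive b)) end≡
  where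
  open ≡-Reasoning
  false≡ : false ≡ not (end (not b) n)
  false≡ = cong not (sym (trans (end-not b n) (cong not end≡)))
  z-eq : z (suc n) ≡ alternating (not b) (suc (suc n))
  z-eq = begin
    z (suc n)                                            ≡⟨ z-suc n ⟩
    negate (z n) ∷ʳ false                                ≡⟨ cong (λ y → negate y ∷ʳ false) z≡ ⟩
    negate (alternating b (suc n)) ∷ʳ false              ≡⟨ cong₂ _∷ʳ_ (negate-alternating b (suc n)) false≡ ⟩
    alternating (not b) (suc n) ∷ʳ not (end (not b) n)   ≡⟨ alternating-∷ʳ (not b) n ⟩
    alternating (not b) (suc (suc n))                    ∎

≡⊎≡not : ∀ a b → a ≡ b ⊎ a ≡ not b
≡⊎≡not false false = inj₁ refl
≡⊎≡not false true  = inj₂ refl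
≡⊎≡not true  false = inj₂ refl
≡⊎≡not true  true  = inj₁ refl

f≡closedForm-suc : ∀ n .{{_ : NonZero n}} → (∀ y → f n y ≡ closedForm y) →
                   ∀ x → f (suc n) x ≡ closedForm x
f≡closedForm-suc n@(suc _) f≡ x with z-alternating n
... | b , z≡ , end≡ = helper (x ≟ z n) (x ≟ negate (z n))
  where
  z̄≡ : negate (z n) ≡ alternating (not b) (suc n)
  z̄≡ = trans (cong negate z≡) (negate-alternating b (suc n))

  helper : _ → _ → f (suc n) x ≡ closedForm x
  helper (yes refl) _ = trans (f-z n) (sym (trans (cong closedForm z≡)
    (trans (closedForm-alternating b n) (cong (replicate (suc n) ∘ not) end≡))))
  helper (no _) (yes refl) = trans (f-negate-z n) (sym (trans (cong closedForm z̄≡)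
    (trans (closedForm-alternating (not b) n)
      (cong (replicate (suc n) ∘ not) (trans (end-not b n) (cong not end≡))))))
  helper (no x≢z) (no x≢z̄) = begin
    f (suc n) x                     ≡⟨ step-other (f n) x≢z x≢z̄ ⟩
    f n (init x) ∷ʳ last x          ≡⟨ cong (_∷ʳ last x) (f≡ (init x)) ⟩
    closedForm (init x) ∷ʳ last x   ≡⟨ closedForm-∷ʳ (init x) (last x) x≢alternating ⟨
    closedForm (init x ∷ʳ last x)   ≡⟨ cong closedForm (init∷ʳlast x) ⟩
    closedForm x                    ∎
    where
    open ≡-Reasoning
    x≢alternating : ∀ a → init x ∷ʳ last x ≢ alternating a (suc n)
    x≢alternating a eq with ≡⊎≡not a b
    ... | inj₁ refl = x≢z (trans (sym (init∷ʳlast x)) (trans eq (sym z≡)))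
    ... | inj₂ refl = x≢z̄ (trans (sym (init∷ʳlast x)) (trans eq (sym z̄≡)))

f≡closedForm : ∀ n .{{_ : NonZero n}} (x : Config n) → f n x ≡ closedForm x
f≡closedForm (suc zero)      (b ∷ []) = refl
f≡closedForm (suc n@(suc _)) x        = f≡closedForm-suc n (f≡closedForm n) x

-- Raising one bit, and order with a sign.

-- Inductive form of the pair `x`, `x ⊕ e j` with bit `j` of `x` equal to `false`, so that
-- monotonicity can be proved by recursion along the run.
data Raise : Fin n → Config n → Config n → Set where
  here  : {xs : Config n} → Raise zero (false ∷ xs) (true ∷ xs)
  there : ∀ {j : Fin n} {b xs ys} → Raise j xs ys → Raise (suc j) (b ∷ xs) (b ∷ ys)

raise-⊕ : (x : Config n) (i : Fin n) → lookup x i ≡ false → Raise i x (x ⊕ e i)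
raise-⊕ (false ∷ xs) zero    refl =
  subst (λ ys → Raise zero (false ∷ xs) (true ∷ ys))
        (sym (zipWith-identityʳ xor-identityʳ xs)) here
raise-⊕ (b ∷ xs)     (suc i) eq   =
  subst (λ c → Raise (suc i) (b ∷ xs) (c ∷ (xs ⊕ e i)))
        (sym (xor-identityʳ b)) (there (raise-⊕ xs i eq))

-- With the direction as a computed sign, one induction treats increasing and decreasing dependence
-- together.
infix 4 _≤[_]_
_≤[_]_ : Bool → Bool → Bool → Set
a ≤[ true  ] b = a ≤ b
a ≤[ false ] b = b ≤ a

≤[]-refl : ∀ s {a} → a ≤[ s ] a
≤[]-refl true  = ≤-refl
≤[]-refl false = ≤-refl

≤[]-trans : ∀ s {a b c} → a ≤[ s ] b → b ≤[ s ] c → a ≤[ s ] c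
≤[]-trans true  p q = ≤-trans p q
≤[]-trans false p q = ≤-trans q p

≤[not]⇒≥[] : ∀ s {a b} → a ≤[ not s ] b → b ≤[ s ] a
≤[not]⇒≥[] true  p = p
≤[not]⇒≥[] false p = p

-- Signs of the components of the closed form.

-- If the run reaches the raised bit after `false`, the old value ends it with result `true`; after
-- `true`, the new value ends it with result `false`. Either extreme settles the inequality.
runEnd-antitone : ∀ b {j : Fin n} {xs ys} → Raise j xs ys → runEnd b ys ≤ runEnd b xs
runEnd-antitone false here                  = ≤-maximum _
runEnd-antitone true  here                  = ≤-minimum _
runEnd-antitone false (there {b = false} _) = b≤b
runEnd-antitone false (there {b = true} r)  = runEnd-antitone true r
runEnd-antitone true  (there {b = false} r) = runEnd-antitone false r
runEnd-antitone true  (there {b = true} _)  = b≤b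

runEnd-head : (xs : Config n) → runEnd true xs ≤ runEnd false xs
runEnd-head []           = f≤t
runEnd-head (false ∷ xs) = ≤-maximum _
runEnd-head (true ∷ xs)  = ≤-minimum _

-- This is the bit of `xs` at index `i` whenever `b ∷ xs` alternates that far.
headSign : Bool → Fin n → Bool
headSign b zero    = not b
headSign b (suc i) = headSign (not b) i

headSign-not : ∀ b (i : Fin n) → headSign (not b) i ≡ not (headSign b i)
headSign-not b zero    = refl
headSign-not b (suc i) = headSign-not (not b) i

-- On an alternating run, lookup xs i is determined by b and the parity of i,
-- so the values that flipRun changes at index i all change in one direction.
flipRun-lookup : ∀ b (xs : Config n) i → lookup (flipRun b xs) i ≤[ headSign b i ] lookup xs i
flipRun-lookup false (false ∷ xs) i       = ≤[]-refl (headSign false i)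
flipRun-lookup false (true ∷ xs)  zero    = ≤-maximum _
flipRun-lookup false (true ∷ xs)  (suc i) = flipRun-lookup true xs i
flipRun-lookup true  (false ∷ xs) zero    = ≤-minimum _
flipRun-lookup true  (false ∷ xs) (suc i) = flipRun-lookup false xs i
flipRun-lookup true  (true ∷ xs)  i       = ≤[]-refl (headSign true i)

lookup-flipRun-true : (xs : Config n) (i : Fin n) →
  lookup xs i ≤[ headSign false i ] lookup (flipRun true xs) i
lookup-flipRun-true xs i = ≤[not]⇒≥[] (headSign false i)
  (subst (λ s → lookup (flipRun true xs) i ≤[ s ] lookup xs i)
         (headSign-not false i) (flipRun-lookup true xs i))

-- The bit of `xs` itself lies between the two sides.
flipRun-head : (xs : Config n) (i : Fin n) →
  lookup (flipRun false xs) i ≤[ headSign false i ] lookup (flipRun true xs) i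
flipRun-head xs i =
  ≤[]-trans (headSign false i) (flipRun-lookup false xs i) (lookup-flipRun-true xs i)

tailSign : Fin n → Fin n → Bool
tailSign zero    zero    = true
tailSign zero    (suc j) = false
tailSign (suc i) zero    = headSign false i
tailSign (suc i) (suc j) = tailSign i j

lookup-raise : ∀ (i : Fin n) {j xs ys} → Raise j xs ys → lookup xs i ≤[ tailSign i j ] lookup ys i
lookup-raise zero    here      = f≤t
lookup-raise (suc i) here      = ≤[]-refl (headSign false i)
lookup-raise zero    (there _) = b≤b
lookup-raise (suc i) (there r) = lookup-raise i r

-- When the raised bit directly follows `b`, one of its values ends the run, and `xs` is then
-- copied. What remains is one half of the comparison in `flipRun-head`, so the sign does not depend
-- on `b`.
flipRun-raise : ∀ b (i : Fin n) {j xs ys} → Raise j xs ys →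
                lookup (flipRun b xs) i ≤[ tailSign i j ] lookup (flipRun b ys) i
flipRun-raise false zero    here                    = ≤-minimum _
flipRun-raise true  zero    here                    = ≤-maximum _
flipRun-raise false (suc i) (here {xs = xs})        = lookup-flipRun-true xs i
flipRun-raise true  (suc i) (here {xs = xs})        = flipRun-lookup false xs i
flipRun-raise false i       r@(there {b = false} _) = lookup-raise i r
flipRun-raise false zero    (there {b = true} r)    = runEnd-antitone true r
flipRun-raise false (suc i) (there {b = true} r)    = flipRun-raise true i r
flipRun-raise true  zero    (there {b = false} r)   = runEnd-antitone false r
flipRun-raise true  (suc i) (there {b = false} r)   = flipRun-raise false i r
flipRun-raise true  i       r@(there {b = true} _)  = lookup-raise i r

-- Differs from `tailSign` only at `zero`, `zero`: the first component always lies in the run and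
-- decreases in its own bit, whereas a later one copies its bit beyond the run.
sign : Fin n → Fin n → Bool
sign zero    _       = false
sign (suc i) zero    = headSign false i
sign (suc i) (suc j) = tailSign i j

closedForm-raise : ∀ (i : Fin n) {j x y} → Raise j x y →
                   lookup (closedForm x) i ≤[ sign i j ] lookup (closedForm y) i
closedForm-raise zero    (here {xs = xs})  = runEnd-head xs
closedForm-raise zero    (there {b = b} r) = runEnd-antitone b r
closedForm-raise (suc i) (here {xs = xs})  = flipRun-head xs i
closedForm-raise (suc i) (there {b = b} r) = flipRun-raise b i r

monotone⇒unate : (g : Config n → Bool) (s : Fin n → Bool) →
                 (∀ {i x y} → Raise i x y → g x ≤[ s i ] g y) → UnateFunction g
monotone⇒unate g s mono i with s i | mono {i}
... | true  | m = inj₁ λ x eq → m (raise-⊕ x i eq)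
... | false | m = inj₂ λ x eq → m (raise-⊕ x i eq)

theorem4p2 : (n : ℕ) → .{{_ : NonZero n}} → Unate (f n)
theorem4p2 n i = monotone⇒unate _ (sign i) λ {j} {x} {y} r →
  subst₂ (λ u v → lookup u i ≤[ sign i j ] lookup v i)
         (sym (f≡closedForm n x)) (sym (f≡closedForm n y)) (closedForm-raise i r)
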